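{- Let $\mathcal{F}$ be a finite union-closed family of sets with $\emptyset \notin \mathcal{F}$, let $n = |\bigcup_{A\in\mathcal{F}} A|$ and $m = |\mathcal{F}|$. If the height number satisfies $H(\mathcal{F}) \le 3$ or $H(\mathcal{F}) \ge n-1$, then there exists an element $x$ which belongs to more than half of the sets of $\mathcal{F}$, i.e. $|\{A\in\mathcal{F} : x\in A\}| > m/2$.
   Context: A union-closed family is a finite family $\mathcal{F}$ of finite sets such that $A\cup B\in\mathcal{F}$ whenever $A,B\in\mathcal{F}$. Height decomposition: let $\pi_1$ be the set of inclusion-minimal members of $\mathcal{F}$, i.e. $\pi_1=\{A\in\mathcal{F} : \forall B\in\mathcal{F},\ B\neq A \Rightarrow B\not\subseteq A\}$; inductively, while $\mathcal{F}\setminus(\pi_1\cup\dots\cup\pi_{i-1})$ is nonempty, let $\pi_i$ be the set of inclusion-minimal members of $\mathcal{F}\setminus(\pi_1\cup\dots\cup\pi_{i-1})$. The process stops after finitely many steps; the number of steps $H$ with $\mathcal{F}=\bigcup_{i=1}^{H}\pi_i$ is the height number $H(\mathcal{F})$. -}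

module Defs where

open import Data.Nat using (ℕ; zero; suc)
import Data.Bool.Properties as BoolP
open import Data.List using (List; []; _∷_; filter; length)
open import Data.List.Membership.Propositional using (_∈_)
open import Data.Fin using (Fin)
open import Data.Fin.Subset using (Subset; _∪_; _⊆_)
  renaming (_∈_ to _∈ₛ_)
open import Data.Fin.Subset.Properties using (_⊆?_; _∈?_)
open import Data.Vec.Properties using (≡-dec)
open import Relation.Nullary using (¬_; Dec; yes; no; ¬?; _×-dec_)
open import Data.Product using (_×_)
open import Data.List.Relation.Unary.All using (All; all?)
open import Relation.Binary.PropositionalEquality using (_≡_)

-- Finite sets are modelled as subsets of a finite ground set Fin k;
-- a finite family is a duplicate-free list of such subsets.

UnionClosed : ∀ {k} → List (Subset k) → Set
UnionClosed F = ∀ {A B} → A ∈ F → B ∈ F → (A ∪ B) ∈ F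

_≟ₛ_ : ∀ {k} (A B : Subset k) → Dec (A ≡ B)
_≟ₛ_ = ≡-dec BoolP._≟_

MinimalIn : ∀ {k} → List (Subset k) → Subset k → Set
MinimalIn L A = All (λ B → ¬ (¬ (B ≡ A) × B ⊆ A)) L

minimalIn? : ∀ {k} (L : List (Subset k)) (A : Subset k) → Dec (MinimalIn L A)
minimalIn? L A = all? (λ B → ¬? ((¬? (B ≟ₛ A)) ×-dec (B ⊆? A))) L

minimals : ∀ {k} → List (Subset k) → List (Subset k)
minimals L = filter (minimalIn? L) L

removeMinimals : ∀ {k} → List (Subset k) → List (Subset k)
removeMinimals L = filter (λ A → ¬? (minimalIn? L A)) L
  
heightAux : ∀ {k} → ℕ → List (Subset k) → ℕ
heightAux zero    _       = zero
heightAux (suc f) []      = zero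
heightAux (suc f) (A ∷ L) = suc (heightAux f (removeMinimals (A ∷ L)))

-- height number H(F): every peeling step removes at least one set
-- (a nonempty finite poset has minimal elements), so |F| steps of fuel suffice.
height : ∀ {k} → List (Subset k) → ℕ
height F = heightAux (length F) F

freq : ∀ {k} → Fin k → List (Subset k) → ℕ
freq x F = length (filter (λ A → x ∈? A) F)

{-# OPTIONS --safe #-}
module Submission where

-- If fewer members miss both x and y than contain both, inclusion–exclusion makes x or y
-- abundant. A member S = {x, y} (possibly x = y) achieves this: D ↦ D ∪ S sends the members
-- missing x and y injectively to members containing both, and never hits S. When the height
-- is at least n − 1, the bottom of a longest chain is such an S. When the longest chains have
-- three members A ⊂ B ⊂ C, take w ∈ B \ A, x ∈ C \ B and z ∈ A: if neither w nor z is missed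
-- by at most one member, then A is the only member missing both x and w, while C and some
-- other member contain both. Shorter longest chains leave even less room.

open import Defs
open import Data.Nat using (ℕ; zero; suc; _+_; _≤_; _<_; _*_; _∸_; z≤n; s≤s; s≤s⁻¹)
open import Data.Nat.Properties
open import Data.Nat.Tactic.RingSolver using (solve-∀)
open import Data.Fin as Fin using (Fin)
open import Data.Fin.Subset using (Subset; ⊥; ⋃; ∣_∣; _∪_; _⊆_; _⊂_; _-_; ⁅_⁆; Nonempty)
  renaming (_∈_ to _∈ₛ_; _∉_ to _∉ₛ_)
open import Data.Fin.Subset.Properties
  using (_∈?_; _⊂?_; ⊆-antisym; ⊂-irref; ⊂-trans; p⊂q⇒∣p∣<∣q∣; p⊆q⇒∣p∣≤∣q∣; p⊆p∪q; q⊆p∪q;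
         x∈p∪q⁻; p─q⊆p; nonempty?; Empty-unique; x∈p⇒∣p-x∣<∣p∣; x∈p∧x≢y⇒x∈p-y)
open import Data.List using (List; []; _∷_; length; filter)
open import Data.List.Properties using (filter-notAll)
open import Data.List.Membership.Propositional using (_∈_; _∉_; find; lose)
open import Data.List.Membership.Propositional.Properties using (∈-filter⁺; ∈-filter⁻)
open import Data.List.Relation.Unary.All as All using (All; []; _∷_)
open import Data.List.Relation.Unary.AllPairs as AllPairs using (AllPairs; []; _∷_)
open import Data.List.Relation.Unary.Any using (here; there; any?)
open import Data.List.Relation.Unary.Linked using ([-]; _∷_)
open import Data.List.Relation.Unary.Linked.Properties using (Linked⇒AllPairs)
open import Data.List.Relation.Unary.Unique.Propositional using (Unique)
open import Data.List.Relation.Unary.Unique.Propositional.Properties using (filter⁺)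
open import Data.Product using (∃; ∃₂; _×_; _,_; proj₁)
open import Data.Sum using (_⊎_; inj₁; inj₂; [_,_]′)
open import Function using (id; const; _∘_)
open import Relation.Binary.Definitions using (DecidableEquality)
open import Relation.Binary.PropositionalEquality
  using (_≡_; _≢_; refl; sym; trans; cong; subst)
open import Relation.Nullary using (¬_; yes; no; ¬?; _×-dec_; contradiction)
open import Relation.Nullary.Decidable using (decidable-stable)

-- Injections between finite lists.

module _ {A B : Set} (_≟_ : DecidableEquality B) where

  -- Deleting `f x` from `ys` keeps the images of the later entries, which differ from `f x` by
  -- injectivity and uniqueness.
  injectiveOn⇒length≤ : (f : A → B) {xs : List A} {ys : List B} → Unique xs →
    (∀ {a} → a ∈ xs → f a ∈ ys) →
    (∀ {a b} → a ∈ xs → b ∈ xs → f a ≡ f b → a ≡ b) →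
    length xs ≤ length ys
  injectiveOn⇒length≤ f {[]} _ _ _ = z≤n
  injectiveOn⇒length≤ f {x ∷ xs} {ys} (x≢xs ∷ u) into inj = ≤-<-trans
    (injectiveOn⇒length≤ f u
      (λ a∈xs → ∈-filter⁺ (λ b → ¬? (b ≟ f x)) (into (there a∈xs))
        λ fa≡fx → All.lookup x≢xs a∈xs (inj (here refl) (there a∈xs) (sym fa≡fx)))
      (λ a∈xs b∈xs → inj (there a∈xs) (there b∈xs)))
    (filter-notAll (λ b → ¬? (b ≟ f x)) ys (lose (into (here refl)) λ ne → ne refl))

  injectiveOn-avoiding⇒length< : (f : A → B) {xs : List A} {ys : List B} {c : B} → Unique xs →
    c ∈ ys → (∀ {a} → a ∈ xs → f a ∈ ys × f a ≢ c) →
    (∀ {a b} → a ∈ xs → b ∈ xs → f a ≡ f b → a ≡ b) →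
    length xs < length ys
  injectiveOn-avoiding⇒length< f {ys = ys} {c} u c∈ys into inj = ≤-<-trans
    (injectiveOn⇒length≤ f u
      (λ a∈xs → let (fa∈ys , fa≢c) = into a∈xs in ∈-filter⁺ (λ b → ¬? (b ≟ c)) fa∈ys fa≢c) inj)
    (filter-notAll (λ b → ¬? (b ≟ c)) ys (lose c∈ys λ ne → ne refl))

-- Finite subsets.

module _ {k : ℕ} where

  -- Longest chains refute strict inclusions; decidable membership turns such a refutation into the
  -- reverse inclusion.
  ⊆∧⊄⇒⊇ : {A B : Subset k} → A ⊆ B → ¬ A ⊂ B → B ⊆ A
  ⊆∧⊄⇒⊇ {A} A⊆B A⊄B {x} x∈B = decidable-stable (x ∈? A) λ x∉A → A⊄B (A⊆B , x , x∈B , x∉A)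

  ∉-∪ : {x : Fin k} (A B : Subset k) → x ∉ₛ A → x ∉ₛ B → x ∉ₛ A ∪ B
  ∉-∪ A B x∉A x∉B = [ x∉A , x∉B ]′ ∘ x∈p∪q⁻ A B

  ≢⊥⇒Nonempty : {A : Subset k} → A ≢ ⊥ → Nonempty A
  ≢⊥⇒Nonempty {A} A≢⊥ = decidable-stable (nonempty? A) (A≢⊥ ∘ Empty-unique)

  -- The two elements may coincide, which covers singletons. A third element would allow three
  -- successive removals, each lowering the size.
  ∣p∣≤2⇒pair : {A : Subset k} → Nonempty A → ∣ A ∣ ≤ 2 →
    ∃₂ λ x y → x ∈ₛ A × y ∈ₛ A × (∀ {z} → z ∈ₛ A → z ≡ x ⊎ z ≡ y)
  ∣p∣≤2⇒pair {A} (x , x∈A) ∣A∣≤2 with nonempty? (A - x)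
  ... | no empty = x , x , x∈A , x∈A , λ {z} z∈A →
        inj₁ (decidable-stable (z Fin.≟ x) λ z≢x → empty (z , x∈p∧x≢y⇒x∈p-y z∈A z≢x))
  ... | yes (y , y∈A-x) = x , y , x∈A , p─q⊆p A ⁅ x ⁆ y∈A-x , cover
    where
    cover : ∀ {z} → z ∈ₛ A → z ≡ x ⊎ z ≡ y
    cover {z} z∈A with z Fin.≟ x | z Fin.≟ y
    ... | yes z≡x | _       = inj₁ z≡x
    ... | no _    | yes z≡y = inj₂ z≡y
    ... | no z≢x  | no z≢y  = contradiction ∣A∣≤2 (<⇒≱ 2<∣A∣)
      where
      2<∣A∣ : 2 < ∣ A ∣
      2<∣A∣ = ≤-<-trans (≤-<-trans (≤-<-trans z≤n
        (x∈p⇒∣p-x∣<∣p∣ (x∈p∧x≢y⇒x∈p-y (x∈p∧x≢y⇒x∈p-y z∈A z≢x) z≢y)))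
        (x∈p⇒∣p-x∣<∣p∣ y∈A-x)) (x∈p⇒∣p-x∣<∣p∣ x∈A)

  -- Pair counts and abundant elements.

  containing missing : Fin k → Fin k → List (Subset k) → List (Subset k)
  containing x y = filter λ A → (x ∈? A) ×-dec (y ∈? A)
  missing    x y = filter λ A → ¬? (x ∈? A) ×-dec ¬? (y ∈? A)

  -- A member containing both elements adds two to each side, any other member adds one.
  freq-inclusion-exclusion : ∀ x y F →
    freq x F + freq y F + length (missing x y F) ≡ length F + length (containing x y F)
  freq-inclusion-exclusion x y [] = refl
  freq-inclusion-exclusion x y (A ∷ F)
    with ih ← freq-inclusion-exclusion x y F | x ∈? A | y ∈? A
  ... | yes _ | yes _ = trans (both (freq x F) _ _) (trans (cong (2 +_) ih) (sym (cong suc (+-suc _ _))))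
    where
    both : ∀ a b c → suc a + suc b + c ≡ 2 + (a + b + c)
    both = solve-∀
  ... | yes _ | no _  = cong suc ih
  ... | no _  | yes _ = trans (cong (_+ length (missing x y F)) (+-suc (freq x F) _)) (cong suc ih)
  ... | no _  | no _  = trans (+-suc _ _) (cong suc ih)

  missing<containing⇒abundant : ∀ x y F → length (missing x y F) < length (containing x y F) →
    ∃ λ z → length F < 2 * freq z F
  missing<containing⇒abundant x y F miss<both
    with length F <? 2 * freq x F | length F <? 2 * freq y F
  ... | yes x-abundant | _              = x , x-abundant
  ... | no _           | yes y-abundant = y , y-abundant
  ... | no x-rare      | no y-rare      = contradiction (begin-strict
      length F + length (containing x y F)              ≡⟨ freq-inclusion-exclusion x y F ⟨
      freq x F + freq y F + length (missing x y F)      ≤⟨ +-monoˡ-≤ _ fx+fy≤m ⟩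
      length F + length (missing x y F)                 <⟨ +-monoʳ-< (length F) miss<both ⟩
      length F + length (containing x y F)              ∎) (<-irrefl refl)
    where
    open ≤-Reasoning
    fx+fy≤m : freq x F + freq y F ≤ length F
    fx+fy≤m = *-cancelˡ-≤ 2 (begin
      2 * (freq x F + freq y F)    ≡⟨ *-distribˡ-+ 2 (freq x F) (freq y F) ⟩
      2 * freq x F + 2 * freq y F  ≤⟨ +-mono-≤ (≮⇒≥ x-rare) (≮⇒≥ y-rare) ⟩
      length F + length F          ≡⟨ cong (length F +_) (+-identityʳ _) ⟨
      2 * length F                 ∎)

  -- `S` contains both elements but is not an image under `f`, which makes the comparison of counts
  -- strict.
  injection⇒abundant : ∀ {F} → Unique F → ∀ x y {S} → S ∈ F → x ∈ₛ S → y ∈ₛ S →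
    (f : Subset k → Subset k) →
    (∀ {D} → D ∈ F → x ∉ₛ D → y ∉ₛ D → f D ∈ F × x ∈ₛ f D × y ∈ₛ f D × f D ≢ S) →
    (∀ {D E} → D ∈ F → x ∉ₛ D → y ∉ₛ D → E ∈ F → x ∉ₛ E → y ∉ₛ E → f D ≡ f E → D ≡ E) →
    ∃ λ z → length F < 2 * freq z F
  injection⇒abundant {F} u x y S∈F x∈S y∈S f into inj = missing<containing⇒abundant x y F
    (injectiveOn-avoiding⇒length< _≟ₛ_ f (filter⁺ miss? u) (∈-filter⁺ both? S∈F (x∈S , y∈S))
      (λ D∈ → let D∈F , x∉D , y∉D = ∈-filter⁻ miss? {xs = F} D∈
                  fD∈F , x∈fD , y∈fD , fD≢S = into D∈F x∉D y∉D
              in ∈-filter⁺ both? fD∈F (x∈fD , y∈fD) , fD≢S)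
      (λ D∈ E∈ → let D∈F , x∉D , y∉D = ∈-filter⁻ miss? {xs = F} D∈
                     E∈F , x∉E , y∉E = ∈-filter⁻ miss? {xs = F} E∈
                 in inj D∈F x∉D y∉D E∈F x∉E y∉E))
    where
    both? = λ A → (x ∈? A) ×-dec (y ∈? A)
    miss? = λ A → ¬? (x ∈? A) ×-dec ¬? (y ∈? A)

  small-member⇒abundant : ∀ {F} → Unique F → UnionClosed F → ⊥ ∉ F →
    ∀ {A} → A ∈ F → ∣ A ∣ ≤ 2 → ∃ λ z → length F < 2 * freq z F
  small-member⇒abundant {F} u closed ⊥∉F {A} A∈F ∣A∣≤2
    with x , y , x∈A , y∈A , cover ← ∣p∣≤2⇒pair (≢⊥⇒Nonempty λ { refl → ⊥∉F A∈F }) ∣A∣≤2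
    = injection⇒abundant u x y A∈F x∈A y∈A (_∪ A)
        (λ {D} D∈F x∉D y∉D → closed D∈F A∈F , q⊆p∪q D A x∈A , q⊆p∪q D A y∈A ,
          -- If `D ∪ A` were `A`, the nonempty `D` would lie inside `A`, from which it is disjoint.
          λ D∪A≡A → let d , d∈D = ≢⊥⇒Nonempty λ { refl → ⊥∉F D∈F } in
            disjoint x∉D y∉D d∈D (subst (d ∈ₛ_) D∪A≡A (p⊆p∪q A d∈D)))
        (λ D∈F x∉D y∉D E∈F x∉E y∉E D∪A≡E∪A →
          ⊆-antisym (reflects x∉D y∉D D∪A≡E∪A) (reflects x∉E y∉E (sym D∪A≡E∪A)))
    where
    disjoint : ∀ {D z} → x ∉ₛ D → y ∉ₛ D → z ∈ₛ D → z ∉ₛ A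
    disjoint x∉D y∉D z∈D z∈A = [ (λ { refl → x∉D z∈D }) , (λ { refl → y∉D z∈D }) ]′ (cover z∈A)

    -- `D` is disjoint from `A`, so an element of `D` found in `E ∪ A` comes from `E`.
    reflects : ∀ {D E} → x ∉ₛ D → y ∉ₛ D → D ∪ A ≡ E ∪ A → D ⊆ E
    reflects {D} {E} x∉D y∉D D∪A≡E∪A {z} z∈D =
      [ id , (λ z∈A → contradiction z∈A (disjoint x∉D y∉D z∈D)) ]′
        (x∈p∪q⁻ E A (subst (z ∈ₛ_) D∪A≡E∪A (p⊆p∪q A z∈D)))

  -- Chains and the height number.

  Chain : List (Subset k) → List (Subset k) → Set
  Chain L xs = AllPairs _⊂_ xs × All (_∈ L) xs

  Longest : List (Subset k) → List (Subset k) → Set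
  Longest L xs = Chain L xs × (∀ {ys} → Chain L ys → length ys ≤ length xs)

  nonminimal⇒∃⊂ : ∀ L {A} → ¬ MinimalIn L A → ∃ λ B → B ∈ L × B ⊂ A
  nonminimal⇒∃⊂ L {A} ¬min with any? (_⊂? A) L
  ... | yes smaller = find smaller
  ... | no none = contradiction (All.tabulate λ B∈L (B≢A , B⊆A) →
          B≢A (⊆-antisym B⊆A (⊆∧⊄⇒⊇ B⊆A (none ∘ lose B∈L)))) ¬min

  -- The bottom of a chain in the peeled remainder is not minimal in `L`, so a member of `L`
  -- strictly below it lengthens the chain by one.
  heightAux-chain : ∀ f L → ∃ λ xs → Chain L xs × length xs ≡ heightAux f L
  heightAux-chain zero    _       = [] , ([] , []) , refl
  heightAux-chain (suc f) []      = [] , ([] , []) , refl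
  heightAux-chain (suc f) L@(A ∷ _) with heightAux-chain f (removeMinimals L)
  ... | [] , _ , eq = A ∷ [] , ([] ∷ [] , here refl ∷ []) , cong suc eq
  ... | B ∷ xs , (B⊂xs ∷ xs↗ , B∈ ∷ xs∈) , eq
    with B∈L , ¬min ← ∈-filter⁻ (λ A → ¬? (minimalIn? L A)) {xs = L} B∈
    with C , C∈L , C⊂B ← nonminimal⇒∃⊂ L ¬min
    = C ∷ B ∷ xs
    , ( (C⊂B ∷ All.map (⊂-trans C⊂B) B⊂xs) ∷ B⊂xs ∷ xs↗
      , C∈L ∷ B∈L ∷ All.map (λ X∈ → proj₁ (∈-filter⁻ (λ A → ¬? (minimalIn? L A)) {xs = L} X∈)) xs∈)
    , cong suc eq

  -- One peeling removes at most the bottom of a chain, because every later member has that bottom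
  -- strictly below it.
  chain⇒≤heightAux : ∀ f {L xs} → length xs ≤ f → Chain L xs → length xs ≤ heightAux f L
  chain⇒≤heightAux f {xs = []} _ _ = z≤n
  chain⇒≤heightAux (suc f) {L@(_ ∷ _)} {A ∷ xs} (s≤s len≤f) (A⊂xs ∷ xs↗ , A∈L ∷ xs∈L) =
    s≤s (chain⇒≤heightAux f len≤f (xs↗ , All.zipWith nonminimal (A⊂xs , xs∈L)))
    where
    nonminimal : ∀ {B} → A ⊂ B × B ∈ L → B ∈ removeMinimals L
    nonminimal (A⊂B , B∈L) = ∈-filter⁺ (λ A → ¬? (minimalIn? L A)) B∈L λ min →
      All.lookup min A∈L ((λ A≡B → ⊂-irref A≡B A⊂B) , proj₁ A⊂B)

  -- Guarantees that the fuel `length F` in `height` suffices for every chain.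
  chain⇒length≤ : ∀ {L xs} → Chain L xs → length xs ≤ length L
  chain⇒length≤ (xs↗ , xs∈L) = injectiveOn⇒length≤ _≟ₛ_ id
    (AllPairs.map (λ A⊂B A≡B → ⊂-irref A≡B A⊂B) xs↗) (All.lookup xs∈L) (λ _ _ → id)

  longest-chain : ∀ F → ∃ λ xs → Longest F xs × length xs ≡ height F
  longest-chain F with xs , chain , eq ← heightAux-chain (length F) F
    = xs , (chain , λ {ys} c → subst (length ys ≤_) (sym eq)
        (chain⇒≤heightAux (length F) (chain⇒length≤ c) c)) , eq

  -- Each step up the chain adds at least one element.
  chain-size : ∀ {F N A xs} → (∀ {B} → B ∈ F → ∣ B ∣ ≤ N) → Chain F (A ∷ xs) →
    ∣ A ∣ + length xs ≤ N
  chain-size {A = A} {[]} bound (_ , A∈F ∷ _) = subst (_≤ _) (sym (+-identityʳ ∣ A ∣)) (bound A∈F)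
  chain-size {N = N} {A} {B ∷ xs} bound ((A⊂B ∷ _) ∷ xs↗ , _ ∷ xs∈F) = begin
    ∣ A ∣ + suc (length xs)  ≡⟨ +-suc ∣ A ∣ _ ⟩
    suc ∣ A ∣ + length xs    ≤⟨ +-monoˡ-≤ (length xs) (p⊂q⇒∣p∣<∣q∣ A⊂B) ⟩
    ∣ B ∣ + length xs        ≤⟨ chain-size bound (xs↗ , xs∈F) ⟩
    N                        ∎
    where open ≤-Reasoning

  ∈⇒⊆⋃ : ∀ {F : List (Subset k)} {A} → A ∈ F → A ⊆ ⋃ F
  ∈⇒⊆⋃ {A ∷ F} (here refl) = p⊆p∪q (⋃ F)
  ∈⇒⊆⋃ {B ∷ F} (there A∈F) = q⊆p∪q B (⋃ F) ∘ ∈⇒⊆⋃ A∈F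

-- Families whose longest chains have at most three members.

module _ {k : ℕ} {F : List (Subset k)}
  (unique : Unique F) (closed : UnionClosed F) (⊥∉F : ⊥ ∉ F) where

  private
    Abundant : Set
    Abundant = ∃ λ z → length F < 2 * freq z F

    element : ∀ {A} → A ∈ F → Nonempty A
    element A∈F = ≢⊥⇒Nonempty λ { refl → ⊥∉F A∈F }

    absurd-missing⇒abundant : ∀ x y {S} → S ∈ F → x ∈ₛ S → y ∈ₛ S →
      (∀ {D} → D ∈ F → x ∉ₛ D → ¬ y ∉ₛ D) → Abundant
    absurd-missing⇒abundant x y S∈F x∈S y∈S never = injection⇒abundant unique x y S∈F x∈S y∈S id
      (λ D∈F x∉D y∉D → contradiction y∉D (never D∈F x∉D))
      (λ D∈F x∉D y∉D → contradiction y∉D (never D∈F x∉D))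

    -- Two members contain both elements and at most one misses both, so the constant map to `T` is
    -- injective there and avoids `S`.
    single-missing⇒abundant : ∀ x y {S T} → S ∈ F → T ∈ F → S ≢ T →
      x ∈ₛ S → y ∈ₛ S → x ∈ₛ T → y ∈ₛ T →
      (∀ {D E} → D ∈ F → x ∉ₛ D → y ∉ₛ D → E ∈ F → x ∉ₛ E → y ∉ₛ E → D ≡ E) → Abundant
    single-missing⇒abundant x y {T = T} S∈F T∈F S≢T x∈S y∈S x∈T y∈T single =
      injection⇒abundant unique x y S∈F x∈S y∈S (const T)
        (λ _ _ _ → T∈F , x∈T , y∈T , S≢T ∘ sym)
        (λ D∈F x∉D y∉D E∈F x∉E y∉E _ → single D∈F x∉D y∉D E∈F x∉E y∉E)

  longest-chain-1⇒abundant : ∀ {C} → Longest F (C ∷ []) → Abundant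
  longest-chain-1⇒abundant {C} ((_ , C∈F ∷ []) , longest) with z , z∈C ← element C∈F =
    absurd-missing⇒abundant z z C∈F z∈C z∈C λ {D} D∈F z∉D _ →
      no-2-chain D∈F (closed D∈F C∈F) (p⊆p∪q C , z , q⊆p∪q D C z∈C , z∉D)
    where
    no-2-chain : ∀ {P Q} → P ∈ F → Q ∈ F → ¬ P ⊂ Q
    no-2-chain P∈F Q∈F P⊂Q =
      <⇒≱ (s≤s (s≤s z≤n)) (longest (Linked⇒AllPairs ⊂-trans (P⊂Q ∷ [-]) , P∈F ∷ Q∈F ∷ []))

  longest-chain-2⇒abundant : ∀ {A C} → Longest F (A ∷ C ∷ []) → Abundant
  longest-chain-2⇒abundant {A} {C} (((A⊂C@(A⊆C , w , w∈C , w∉A) ∷ []) ∷ _ , A∈F ∷ C∈F ∷ []) , longest)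
    with z , z∈A ← element A∈F =
    -- A member `D` missing both would give the chain `D ⊂ D ∪ A ⊂ C`, with `z` and `w` witnessing
    -- strictness.
    absurd-missing⇒abundant z w C∈F (A⊆C z∈A) w∈C λ {D} D∈F z∉D w∉D →
      no-3-chain D∈F (closed D∈F A∈F) C∈F
        (p⊆p∪q A , z , q⊆p∪q D A z∈A , z∉D)
        (⊆top (closed D∈F A∈F) , w , w∈C , ∉-∪ D A w∉D w∉A)
    where
    no-3-chain : ∀ {P Q R} → P ∈ F → Q ∈ F → R ∈ F → P ⊂ Q → ¬ Q ⊂ R
    no-3-chain P∈F Q∈F R∈F P⊂Q Q⊂R = <⇒≱ (s≤s (s≤s (s≤s z≤n)))
      (longest (Linked⇒AllPairs ⊂-trans (P⊂Q ∷ Q⊂R ∷ [-]) , P∈F ∷ Q∈F ∷ R∈F ∷ []))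

    ⊆top : ∀ {X} → X ∈ F → X ⊆ C
    ⊆top {X} X∈F = ⊆∧⊄⇒⊇ (p⊆p∪q X) (no-3-chain A∈F C∈F (closed C∈F X∈F) A⊂C) ∘ q⊆p∪q C X

  longest-chain-3⇒abundant : ∀ {A B C} → Longest F (A ∷ B ∷ C ∷ []) → Abundant
  longest-chain-3⇒abundant {A} {B} {C}
    (((A⊂B@(A⊆B , w , w∈B , w∉A) ∷ _) ∷ (B⊂C@(B⊆C , x , x∈C , x∉B) ∷ []) ∷ _
     , A∈F ∷ B∈F ∷ C∈F ∷ []) , longest)
    with z , z∈A ← element A∈F = split
    where
    no-4-chain : ∀ {P Q R S} → P ∈ F → Q ∈ F → R ∈ F → S ∈ F → P ⊂ Q → Q ⊂ R → ¬ R ⊂ S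
    no-4-chain P∈F Q∈F R∈F S∈F P⊂Q Q⊂R R⊂S = <⇒≱ (s≤s (s≤s (s≤s (s≤s z≤n))))
      (longest (Linked⇒AllPairs ⊂-trans (P⊂Q ∷ Q⊂R ∷ R⊂S ∷ [-]) , P∈F ∷ Q∈F ∷ R∈F ∷ S∈F ∷ []))

    -- Otherwise `C ∪ X` would extend the longest chain at its top.
    ⊆top : ∀ {X} → X ∈ F → X ⊆ C
    ⊆top {X} X∈F =
      ⊆∧⊄⇒⊇ (p⊆p∪q X) (no-4-chain A∈F B∈F C∈F (closed C∈F X∈F) A⊂B B⊂C) ∘ q⊆p∪q C X

    only-A : ∀ {D} → D ∈ F → ¬ D ⊂ D ∪ A → ¬ A ⊂ D ∪ A → D ≡ A
    only-A {D} D∈F D⊄ A⊄ = ⊆-antisym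
      (⊆∧⊄⇒⊇ (q⊆p∪q D A) A⊄ ∘ p⊆p∪q A)
      (⊆∧⊄⇒⊇ (p⊆p∪q A) D⊄ ∘ q⊆p∪q D A)

    -- `D ∪ A` misses `w`, so it cannot exceed `A`; and `D` strictly below `A` would extend the
    -- chain downwards.
    only-A-missing-w : ¬ (∃ λ D → D ∈ F × A ⊂ D × w ∉ₛ D) → ∀ {D} → D ∈ F → w ∉ₛ D → D ≡ A
    only-A-missing-w none {D} D∈F w∉D = ⊆-antisym D⊆A
      (⊆∧⊄⇒⊇ D⊆A λ D⊂A → no-4-chain D∈F A∈F B∈F C∈F D⊂A A⊂B B⊂C)
      where
      D⊆A : D ⊆ A
      D⊆A = ⊆∧⊄⇒⊇ (q⊆p∪q D A)
        (λ A⊂D∪A → none (D ∪ A , closed D∈F A∈F , A⊂D∪A , ∉-∪ D A w∉D w∉A)) ∘ p⊆p∪q A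

    -- `D ∪ E` misses `z`, so `E` cannot lie strictly below it. Applied in both orders, this leaves
    -- at most one member missing `z`.
    minimal-missing-z : ¬ (∃ λ K → K ∈ F × z ∉ₛ K × ∃ λ E → E ∈ F × E ⊂ K) →
      ∀ {D E} → D ∈ F → z ∉ₛ D → E ∈ F → z ∉ₛ E → D ⊆ E
    minimal-missing-z none {D} {E} D∈F z∉D E∈F z∉E =
      ⊆∧⊄⇒⊇ (q⊆p∪q D E)
        (λ E⊂D∪E → none (D ∪ E , closed D∈F E∈F , ∉-∪ D E z∉D z∉E , E , E∈F , E⊂D∪E)) ∘ p⊆p∪q E

    -- `D ⊆ B`, since otherwise `A ⊂ B ⊂ D ∪ B ⊂ C`, strict at the top by `x`. Then `D ∪ A ⊂ B` by
    -- `w`, leaving no room for `D` or `A` strictly below `D ∪ A`.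
    only-A-missing-xw : ∀ {D} → D ∈ F → x ∉ₛ D → w ∉ₛ D → D ≡ A
    only-A-missing-xw {D} D∈F x∉D w∉D = only-A D∈F
      (λ D⊂D∪A → no-4-chain D∈F D∪A∈F B∈F C∈F D⊂D∪A D∪A⊂B B⊂C)
      (λ A⊂D∪A → no-4-chain A∈F D∪A∈F B∈F C∈F A⊂D∪A D∪A⊂B B⊂C)
      where
      D∪A∈F = closed D∈F A∈F
      D∪B∈F = closed D∈F B∈F

      D⊆B : D ⊆ B
      D⊆B = ⊆∧⊄⇒⊇ (q⊆p∪q D B)
        (λ B⊂D∪B → no-4-chain A∈F B∈F D∪B∈F C∈F A⊂B B⊂D∪B
          (⊆top D∪B∈F , x , x∈C , ∉-∪ D B x∉D x∉B)) ∘ p⊆p∪q B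

      D∪A⊂B : D ∪ A ⊂ B
      D∪A⊂B = [ D⊆B , A⊆B ]′ ∘ x∈p∪q⁻ D A , w , w∈B , ∉-∪ D A w∉D w∉A

    -- If E ⊂ K and v lay outside both K and P, then E ⊂ K ⊂ K ∪ P ⊂ C would be a 4-chain.
    meets : ∀ {K E P v} → K ∈ F → z ∉ₛ K → E ∈ F → E ⊂ K →
      P ∈ F → z ∈ₛ P → v ∈ₛ C → v ∉ₛ P → v ∈ₛ K
    meets {K} {P = P} {v} K∈F z∉K E∈F E⊂K P∈F z∈P v∈C v∉P =
      decidable-stable (v ∈? K) λ v∉K →
        no-4-chain E∈F K∈F (closed K∈F P∈F) C∈F E⊂K
          (p⊆p∪q P , z , q⊆p∪q K P z∈P , z∉K)
          (⊆top (closed K∈F P∈F) , v , v∈C , ∉-∪ K P v∉K v∉P)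

    split : Abundant
    split with any? (λ D → (A ⊂? D) ×-dec ¬? (w ∈? D)) F
             | any? (λ K → ¬? (z ∈? K) ×-dec any? (_⊂? K) F) F
    ... | no none | _ =
      single-missing⇒abundant w w C∈F B∈F (λ C≡B → ⊂-irref (sym C≡B) B⊂C)
        (B⊆C w∈B) (B⊆C w∈B) w∈B w∈B
        (λ D∈F w∉D _ E∈F w∉E _ → trans (only D∈F w∉D) (sym (only E∈F w∉E)))
      where only = only-A-missing-w λ (D , D∈F , p) → none (lose D∈F p)
    ... | yes _ | no none =
      single-missing⇒abundant z z A∈F B∈F (λ A≡B → ⊂-irref A≡B A⊂B)
        z∈A z∈A (A⊆B z∈A) (A⊆B z∈A)
        (λ D∈F z∉D _ E∈F z∉E _ → ⊆-antisym (below D∈F z∉D E∈F z∉E) (below E∈F z∉E D∈F z∉D))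
      where
      below = minimal-missing-z λ (K , K∈F , z∉K , E , E∈F , E⊂K) →
        none (lose K∈F (z∉K , lose E∈F E⊂K))
    ... | yes someD | yes someK
      with D , D∈F , (A⊆D , _) , w∉D ← find someD
         | K , K∈F , z∉K , someE ← find someK
      with E , E∈F , E⊂K ← find someE =
      -- The second member containing both `x` and `w` is `K`; it differs from `C` because it misses
      -- `z`.
      single-missing⇒abundant x w C∈F K∈F (λ { refl → z∉K (B⊆C (A⊆B z∈A)) })
        x∈C (B⊆C w∈B)
        -- `B` contains `z` but not `x`, and `D` contains `z` but not `w`, so these put `x` and then
        -- `w` into `K`.
        (meets K∈F z∉K E∈F E⊂K B∈F (A⊆B z∈A) x∈C x∉B)
        (meets K∈F z∉K E∈F E⊂K D∈F (A⊆D z∈A) (B⊆C w∈B) w∉D)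
        (λ D∈F x∉D w∉D E∈F x∉E w∉E →
          trans (only-A-missing-xw D∈F x∉D w∉D) (sym (only-A-missing-xw E∈F x∉E w∉E)))

  longest-chain≤3⇒abundant : ∀ {A xs} → Longest F (A ∷ xs) → length xs ≤ 2 → Abundant
  longest-chain≤3⇒abundant {xs = []}         longest _ = longest-chain-1⇒abundant longest
  longest-chain≤3⇒abundant {xs = _ ∷ []}     longest _ = longest-chain-2⇒abundant longest
  longest-chain≤3⇒abundant {xs = _ ∷ _ ∷ []} longest _ = longest-chain-3⇒abundant longest
  longest-chain≤3⇒abundant {xs = _ ∷ _ ∷ _ ∷ _} _ (s≤s (s≤s ()))

-- The two ranges of the height number.

theorem3p1 : ∀ {k : ℕ} (F : List (Subset k)) →
    F ≢ [] → Unique F → UnionClosed F → ⊥ ∉ F →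
    (height F ≤ 3 ⊎ ∣ ⋃ F ∣ ∸ 1 ≤ height F) →
    ∃ λ (x : Fin k) → length F < 2 * freq x F
theorem3p1 [] F≢[] _ _ _ _ = contradiction refl F≢[]
theorem3p1 F@(_ ∷ _) _ unique closed ⊥∉F bounds with longest-chain F
-- The head of `F` alone is already a longer chain.
... | [] , (_ , longest) , _ =
  contradiction (longest ([] ∷ [] , here refl ∷ [])) λ ()
... | A ∷ xs , longest@(chain@(_ , A∈F ∷ _) , _) , len≡H with bounds
...   | inj₁ H≤3 = longest-chain≤3⇒abundant unique closed ⊥∉F longest
  (s≤s⁻¹ (subst (_≤ 3) (sym len≡H) H≤3))
...   | inj₂ n∸1≤H = small-member⇒abundant unique closed ⊥∉F A∈F
  (+-cancelʳ-≤ (length xs) ∣ A ∣ 2 (begin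
    ∣ A ∣ + length xs      ≤⟨ chain-size (p⊆q⇒∣p∣≤∣q∣ ∘ ∈⇒⊆⋃) chain ⟩
    -- Truncated subtraction is harmless here, as only this inequality is needed. The final 2 is
    -- this 1 plus the bottom `A` counted in the height.
    ∣ ⋃ F ∣                ≤⟨ m≤n+m∸n ∣ ⋃ F ∣ 1 ⟩
    1 + (∣ ⋃ F ∣ ∸ 1)      ≤⟨ s≤s n∸1≤H ⟩
    1 + height F           ≡⟨ cong suc len≡H ⟨
    2 + length xs          ∎))
  where open ≤-Reasoning
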